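{- Let $k\ge 2$ be any integer and let $R(k)=\sum_{r=1}^{k}|\mathcal{P}_k(r,k)|$. Then $$R(k)=M_2(k)=\frac{1}{k}\sum_{s\mid k}2^{k/s}\mu(s),$$ where the sum ranges over all positive divisors $s$ of $k$.
   Context: For a finite set $A$ of nonnegative integers and a positive integer $i$, let $\overline{A}(i)\subseteq\{0,1,\ldots,i-1\}$ be the set of residues modulo $i$ of the elements of $A$; two finite sets $A,B$ are called equal modulo $i$ if $\overline{A}(i)=\overline{B}(i)$. Write $A+t=\{a+t: a\in A\}$. For integers $1\le j\le i$, $\mathcal{A}(j,i)$ denotes the collection of all subsets of $\{0,1,\ldots,i-1\}$ with exactly $j$ elements. For $A\in\mathcal{A}(j,i)$, $f_i(A)$ denotes the smallest positive integer $l$ such that $A$ equals $A+l$ modulo $i$ (it exists and is at most $i$). For $1\le s\le i$, $\mathcal{A}_s(j,i)=\{A\in\mathcal{A}(j,i): f_i(A)=s\}$. Two sets $A,A'\in\mathcal{A}_k(r,k)$ are called $k$-equivalent if there exists $j\in\{0,1,\ldots,k-1\}$ such that $A+j$ equals $A'$ modulo $k$; this is an equivalence relation, and $\mathcal{P}_k(r,k)$ denotes the set of its equivalence classes in $\mathcal{A}_k(r,k)$ (empty if $\mathcal{A}_k(r,k)$ is empty). $\mu$ is the Möbius function and $|\cdot|$ denotes cardinality. $M_2(k)$ is the binary case of Moreau's necklace-counting function, i.e. by definition $M_2(k)=\frac1k\sum_{s\mid k}\mu(s)2^{k/s}$. -}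

module Defs where

open import Data.Bool.Properties using () renaming (_≟_ to _≟ᵇ_)
open import Data.Fin using (Fin; toℕ)
open import Data.Fin.Properties using (any?; fromℕ<-cong)
open import Data.Fin.Subset using (Subset; inside; outside; ⁅_⁆; ⋃; ∣_∣)
open import Data.Fin.Subset.Properties using (_∈?_)
open import Data.Integer as ℤ using (ℤ; +_; -[1+_])
open import Data.List using (List; []; _∷_; _++_; map; filter; foldr; length; deduplicate; upTo; allFin)
open import Data.List.Properties using (≡-dec; map-∘; map-cong)
open import Data.List.Relation.Unary.Unique.DecPropositional using (unique?)
open import Data.Nat as ℕ using (ℕ; zero; suc; _+_; _^_; _≤_; z≤n; s≤s; NonZero; >-nonZero⁻¹)
open import Data.Nat.Divisibility using (_∣?_)
open import Data.Nat.DivMod using (_mod_; [m+n]%n≡m%n; m%n<n)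
open import Data.Nat.ListAction using (sum)
open import Data.Nat.Primality.Factorisation using (factorise; factors)
open import Data.Nat.Properties using (_≟_; _≤?_)
open import Data.Product using (_×_; _,_; ∃; proj₁)
open import Data.Rational as ℚ using (ℚ)
open import Data.Vec using ([]; _∷_)
open import Data.Vec.Properties using () renaming (≡-dec to ≡-decᵛ)
open import Function using (_∘_)
open import Relation.Binary using (DecidableEquality)
open import Relation.Binary.PropositionalEquality using (_≡_; refl; sym; trans; cong)
open import Relation.Nullary using (Dec; yes; no; contradiction)
open import Relation.Nullary.Decidable using (_×-dec_; does)
open import Relation.Unary using (Pred; Decidable)
open import Data.Bool using (if_then_else_)
open import Level using (0ℓ)

[1⋯_] : ℕ → List ℕ
[1⋯ n ] = map suc (upTo n)

-- Finite sets of naturals are lists, used only through their residues,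
-- so that order and repetition of entries are irrelevant.
infixl 6 _⊕_
_⊕_ : List ℕ → ℕ → List ℕ
A ⊕ t = map (_+ t) A

residues : (i : ℕ) .{{_ : NonZero i}} → List ℕ → Subset i
residues i A = ⋃ (map (λ a → ⁅ a mod i ⁆) A)

EqualModulo : (i : ℕ) .{{_ : NonZero i}} → List ℕ → List ℕ → Set
EqualModulo i A B = residues i A ≡ residues i B

_≟ˢ_ : ∀ {i} → DecidableEquality (Subset i)
_≟ˢ_ = ≡-decᵛ _≟ᵇ_

equalModulo? : (i : ℕ) .{{_ : NonZero i}} (A B : List ℕ) → Dec (EqualModulo i A B)
equalModulo? i A B = residues i A ≟ˢ residues i B

elements : ∀ {i} → Subset i → List ℕ
elements {i} A = map toℕ (filter (_∈? A) (allFin i))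

-- Every subset of {0,…,i-1}, listed exactly once.
subsets : (i : ℕ) → List (Subset i)
subsets zero    = [] ∷ []
subsets (suc i) = map (outside ∷_) (subsets i) ++ map (inside ∷_) (subsets i)

𝒜 : (j i : ℕ) → List (Subset i)
𝒜 j i = filter (λ A → ∣ A ∣ ≟ j) (subsets i)

Least : Pred ℕ 0ℓ → Pred ℕ 0ℓ
Least P l = P l × (∀ {m} → P m → l ≤ m)

least : {P : Pred ℕ 0ℓ} → Decidable P → (n : ℕ) → P n → ∃ (Least P)
least P? zero    p = zero , p , λ _ → z≤n
least P? (suc n) p with P? zero
... | yes p₀ = zero , p₀ , λ _ → z≤n
... | no ¬p₀ with least (P? ∘ suc) n p
...   | l , pₗ , min = suc l , pₗ , λ { {zero}  q → contradiction q ¬p₀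
                                     ; {suc m} q → s≤s (min q) }

PositivePeriod : (i : ℕ) .{{_ : NonZero i}} → Subset i → Pred ℕ 0ℓ
PositivePeriod i A l = 1 ≤ l × EqualModulo i (elements A) (elements A ⊕ l)

positivePeriod? : (i : ℕ) .{{_ : NonZero i}} (A : Subset i) → Decidable (PositivePeriod i A)
positivePeriod? i A l = (1 ≤? l) ×-dec equalModulo? i (elements A) (elements A ⊕ l)

positivePeriod[i] : (i : ℕ) .{{_ : NonZero i}} (A : Subset i) → PositivePeriod i A i
positivePeriod[i] i A = >-nonZero⁻¹ i , cong ⋃ (trans
  (map-cong (λ a → cong ⁅_⁆ (fromℕ<-cong _ _ (sym ([m+n]%n≡m%n a i)) (m%n<n a i) (m%n<n (a + i) i)))
            (elements A))
  (map-∘ (elements A)))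

f : (i : ℕ) .{{_ : NonZero i}} → Subset i → ℕ
f i A = proj₁ (least (positivePeriod? i A) i (positivePeriod[i] i A))

𝒜ₛ : (s j i : ℕ) .{{_ : NonZero i}} → List (Subset i)
𝒜ₛ s j i = filter (λ A → f i A ≟ s) (𝒜 j i)

Equivalent : (k : ℕ) .{{_ : NonZero k}} → Subset k → Subset k → Set
Equivalent k A A′ = ∃ λ (j : Fin k) → EqualModulo k (elements A ⊕ toℕ j) (elements A′)

equivalent? : (k : ℕ) .{{_ : NonZero k}} (A A′ : Subset k) → Dec (Equivalent k A A′)
equivalent? k A A′ = any? λ j → equalModulo? k (elements A ⊕ toℕ j) (elements A′)

-- A class lists its members in the order of 𝒜ₛ k r k, so two classes have
-- the same members exactly when they are equal as lists.
class : (r k : ℕ) .{{_ : NonZero k}} → Subset k → List (Subset k)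
class r k A = filter (equivalent? k A) (𝒜ₛ k r k)

𝒫 : (r k : ℕ) .{{_ : NonZero k}} → List (List (Subset k))
𝒫 r k = deduplicate (≡-dec _≟ˢ_) (map (class r k) (𝒜ₛ k r k))

R : (k : ℕ) .{{_ : NonZero k}} → ℕ
R k = sum (map (λ r → length (𝒫 r k)) [1⋯ k ])

μ : (n : ℕ) .{{_ : NonZero n}} → ℤ
μ n = if does (unique? _≟_ ps) then -[1+ 0 ] ℤ.^ length ps else + 0
  where ps = factors (factorise n)

-- The divisors are enumerated as suc d, so that the summand may divide by s.
sumOverDivisors : (n : ℕ) → ((s : ℕ) .{{_ : NonZero s}} → ℤ) → ℤ
sumOverDivisors n g =
  foldr ℤ._+_ (+ 0) (map (λ d → g (suc d)) (filter (λ d → suc d ∣? n) (upTo n)))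

syntax sumOverDivisors n (λ s → e) = ∑[ s ∣ n ] e

M : (α k : ℕ) .{{_ : NonZero k}} → ℚ
M α k = (∑[ s ∣ k ] (μ s ℤ.* + (α ^ (k ℕ./ s)))) ℚ./ k

{-# OPTIONS --safe #-}

-- Write N for the number of A ⊆ {0,…,k-1} with f k A = k. A class consists of
-- the k distinct rotations of any of its members, so k R(k) = N (the empty set,
-- omitted from R, has period 1 < k). Rotation by l fixes A exactly when f k A
-- divides l, so for a divisor s of k the 2^(k/s) subsets fixed by rotation by
-- k/s are those with s ∣ k / f k A. Hence Σ_{s∣k} μ(s) 2^(k/s) is the sum over
-- A of Σ_{s ∣ k / f k A} μ(s), and the inner sum is 1 if f k A = k and 0 otherwise.
module Submission where

open import Defs
open import Algebra.Properties.CommutativeSemigroup using (interchange; x∙yz≈y∙xz)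
open import Data.Bool using (Bool; true; false; if_then_else_)
open import Data.Fin as Fin using (Fin; toℕ)
import Data.Fin.Properties as FinP
open import Data.Fin.Subset as Subset using (Subset; inside; outside; ∣_∣; ⊥; ⁅_⁆)
open import Data.Fin.Subset.Properties
  using (_∈?_; x∈⁅x⁆; x∈⁅y⁆⇒x≡y; x∈p∪q⁺; x∈p∪q⁻; ∉⊥; ∣p∣≤n; nonempty?; x∈p⇒∣p-x∣<∣p∣; Empty-unique)
open import Data.Integer as ℤ using (ℤ; +_; -[1+_]; 0ℤ; 1ℤ; -1ℤ)
import Data.Integer.Properties as ℤP
open import Data.List as List using (List; []; _∷_; _++_; map; filter; foldr; length; upTo; allFin; applyUpTo; deduplicate)
open import Data.List.Membership.Propositional using (_∈_; _∉_)
open import Data.List.Membership.Propositional.Properties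
open import Data.List.Membership.Propositional.Properties.WithK using (unique∧set⇒bag)
open import Data.List.Properties
  using (length-map; length-++; length-applyUpTo; map-tabulate; map-cong; map-id; ≡-dec; filter-≐)
open import Data.List.Relation.Binary.BagAndSetEquality using (∼bag⇒↭)
open import Data.List.Relation.Binary.Permutation.Propositional
  using (_↭_; refl; prep; swap; trans; ↭-sym; ↭⇒↭ₛ)
open import Data.List.Relation.Binary.Permutation.Propositional.Properties using (↭-length)
import Data.List.Relation.Binary.Permutation.Setoid.Properties as PermutationS
open import Data.List.Relation.Unary.All as All using ([]; _∷_)
open import Data.List.Relation.Unary.AllPairs using ([]; _∷_)
open import Data.List.Relation.Unary.Any using (here; there)
open import Data.List.Relation.Unary.Unique.DecPropositional using (unique?)
open import Data.List.Relation.Unary.Unique.DecPropositional.Properties using (deduplicate-!)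
open import Data.List.Relation.Unary.Unique.Propositional using (Unique)
import Data.List.Relation.Unary.Unique.Propositional.Properties as Unique
open import Data.Nat as ℕ
  using (ℕ; zero; suc; NonZero; _+_; _*_; _∸_; _^_; _%_; _≤_; _<_; _≥_; z≤n)
open import Data.Nat.Divisibility
open import Data.Nat.DivMod hiding (_/_)
open import Data.Nat.ListAction using (sum; product)
open import Data.Nat.ListAction.Properties using (∈⇒∣product)
open import Data.Nat.Primality using (Prime; euclidsLemma; prime⇒nonZero)
open import Data.Nat.Primality.Factorisation
import Data.Nat.Properties as ℕP
open ℕP using (_≟_)
open import Data.Product using (_×_; _,_; ∃; proj₁; proj₂)
open import Data.Rational using (_/_)
open import Data.Rational.Properties using (fromℚᵘ-cong)
open import Data.Rational.Unnormalised using (mkℚᵘ; *≡*)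
open import Data.Sum using (inj₁; inj₂)
open import Data.Vec as Vec using (lookup; tabulate; []; _∷_)
open import Data.Vec.Properties
  using ([]=⇒lookup; lookup⇒[]=; lookup∘tabulate; tabulate∘lookup; tabulate-cong; ∷-injectiveʳ)
open import Function using (_∘_; id)
open import Function.Bundles using (mk⇔)
open import Level using (Level)
open import Relation.Binary using (DecidableEquality)
open import Relation.Binary.PropositionalEquality as ≡
  using (_≡_; _≢_; _≗_; refl; sym; cong; cong₂; subst; module ≡-Reasoning)
open import Relation.Nullary using (Dec; yes; no; does; contradiction; ¬_; ¬?)
open import Relation.Nullary.Decidable using (does-⇔; dec-true; dec-false)
open import Relation.Unary using (Pred; Decidable)

-- Finite sums

-- Two choices shape the proof. Counts are cast to ℤ at once, because they are weighted by signed
-- values of μ, and the equation k R(k) = N is proved there; division by k happens only at the very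
-- end. Rotation wraps around at k, which would force a case distinction in every argument about it;
-- instead a subset is read as a k-periodic Boolean sequence on ℕ (`at`), on which rotation by j is
-- a shift of the index. The divisor sum of μ needs no multiplicativity: one prime divisor p of n
-- already makes its terms cancel.

private variable
  a b p q : Level
  A : Set a
  B : Set b
  P : Set p
  Q : Set q

-- In a list without repetition every multiplicity is 0 or 1, so having the same members already
-- means being permutations of each other. Every bijective count below is reduced by this to two
-- inclusions.
unique∧⇔⇒↭ : {xs ys : List A} → Unique xs → Unique ys →
             (∀ {x} → x ∈ xs → x ∈ ys) → (∀ {x} → x ∈ ys → x ∈ xs) → xs ↭ ys
unique∧⇔⇒↭ uxs uys xs⊆ys ys⊆xs = ∼bag⇒↭ (unique∧set⇒bag uxs uys (mk⇔ xs⊆ys ys⊆xs))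

𝟙 : Dec P → ℤ
𝟙 P? = if does P? then 1ℤ else 0ℤ

𝟙-⇔ : (P → Q) → (Q → P) → (P? : Dec P) (Q? : Dec Q) → 𝟙 P? ≡ 𝟙 Q?
𝟙-⇔ to from P? Q? = cong (if_then 1ℤ else 0ℤ) (does-⇔ (mk⇔ to from) P? Q?)

𝟙-yes : (P? : Dec P) → P → 𝟙 P? ≡ 1ℤ
𝟙-yes P? p = cong (if_then 1ℤ else 0ℤ) (dec-true P? p)

𝟙-no : (P? : Dec P) → ¬ P → 𝟙 P? ≡ 0ℤ
𝟙-no P? ¬p = cong (if_then 1ℤ else 0ℤ) (dec-false P? ¬p)

∑ : (A → ℤ) → List A → ℤ
∑ g xs = foldr ℤ._+_ (+ 0) (map g xs)

∑-cong-∈ : {g h : A → ℤ} (xs : List A) → (∀ {x} → x ∈ xs → g x ≡ h x) → ∑ g xs ≡ ∑ h xs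
∑-cong-∈ []       eq = refl
∑-cong-∈ (x ∷ xs) eq = cong₂ ℤ._+_ (eq (here refl)) (∑-cong-∈ xs (eq ∘ there))

∑-cong : {g h : A → ℤ} → g ≗ h → ∑ g ≗ ∑ h
∑-cong eq xs = ∑-cong-∈ xs (λ {x} _ → eq x)

∑-zero : (xs : List A) → ∑ (λ _ → 0ℤ) xs ≡ 0ℤ
∑-zero []       = refl
∑-zero (x ∷ xs) = ≡.trans (ℤP.+-identityˡ _) (∑-zero xs)

∑-+ : (g h : A → ℤ) (xs : List A) → ∑ (λ x → g x ℤ.+ h x) xs ≡ ∑ g xs ℤ.+ ∑ h xs
∑-+ g h []       = refl
∑-+ g h (x ∷ xs) = ≡.trans (cong (λ z → g x ℤ.+ h x ℤ.+ z) (∑-+ g h xs))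
                           (interchange ℤP.+-commutativeSemigroup (g x) (h x) (∑ g xs) (∑ h xs))

∑-*ˡ : (c : ℤ) (g : A → ℤ) (xs : List A) → ∑ (λ x → c ℤ.* g x) xs ≡ c ℤ.* ∑ g xs
∑-*ˡ c g []       = sym (ℤP.*-zeroʳ c)
∑-*ˡ c g (x ∷ xs) = ≡.trans (cong (λ z → c ℤ.* g x ℤ.+ z) (∑-*ˡ c g xs)) (sym (ℤP.*-distribˡ-+ c (g x) (∑ g xs)))

∑-swap : (g : A → B → ℤ) (xs : List A) (ys : List B) →
         ∑ (λ x → ∑ (g x) ys) xs ≡ ∑ (λ y → ∑ (λ x → g x y) xs) ys
∑-swap g []       ys = sym (∑-zero ys)
∑-swap g (x ∷ xs) ys = ≡.trans (cong (λ z → ∑ (g x) ys ℤ.+ z) (∑-swap g xs ys)) (sym (∑-+ (g x) _ ys))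

∑-map : (g : B → ℤ) (h : A → B) (xs : List A) → ∑ g (map h xs) ≡ ∑ (g ∘ h) xs
∑-map g h []       = refl
∑-map g h (x ∷ xs) = cong (λ z → g (h x) ℤ.+ z) (∑-map g h xs)

∑-↭ : (g : A → ℤ) {xs ys : List A} → xs ↭ ys → ∑ g xs ≡ ∑ g ys
∑-↭ g refl         = refl
∑-↭ g (prep x p)   = cong (λ z → g x ℤ.+ z) (∑-↭ g p)
∑-↭ g (swap x y p) = ≡.trans (cong (λ z → g x ℤ.+ (g y ℤ.+ z)) (∑-↭ g p)) (x∙yz≈y∙xz ℤP.+-commutativeSemigroup (g x) (g y) _)
∑-↭ g (trans p q)  = ≡.trans (∑-↭ g p) (∑-↭ g q)

∑-filter : {P : Pred A p} (P? : Decidable P) (g : A → ℤ) (xs : List A) →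
           ∑ g (filter P? xs) ≡ ∑ (λ x → 𝟙 (P? x) ℤ.* g x) xs
∑-filter P? g []       = refl
∑-filter P? g (x ∷ xs) with does (P? x)
... | true  = cong₂ ℤ._+_ (sym (ℤP.*-identityˡ (g x))) (∑-filter P? g xs)
... | false = ≡.trans (∑-filter P? g xs) (sym (ℤP.+-identityˡ _))

∑-one : (xs : List A) → ∑ (λ _ → 1ℤ) xs ≡ + length xs
∑-one []       = refl
∑-one (x ∷ xs) = cong (λ z → 1ℤ ℤ.+ z) (∑-one xs)

length-filter≡∑𝟙 : {P : Pred A p} (P? : Decidable P) (xs : List A) →
                   + length (filter P? xs) ≡ ∑ (𝟙 ∘ P?) xs
length-filter≡∑𝟙 P? xs = begin
  + length (filter P? xs)       ≡⟨ ∑-one (filter P? xs) ⟨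
  ∑ (λ _ → 1ℤ) (filter P? xs)   ≡⟨ ∑-filter P? _ xs ⟩
  ∑ (λ x → 𝟙 (P? x) ℤ.* 1ℤ) xs  ≡⟨ ∑-cong (λ x → ℤP.*-identityʳ (𝟙 (P? x))) xs ⟩
  ∑ (𝟙 ∘ P?) xs                 ∎
  where open ≡-Reasoning

+sum≡∑ : (xs : List ℕ) → + sum xs ≡ ∑ +_ xs
+sum≡∑ []       = refl
+sum≡∑ (x ∷ xs) = cong (λ z → + x ℤ.+ z) (+sum≡∑ xs)

∑-point : (_≟_ : DecidableEquality B) {ys : List B} → Unique ys → ∀ {x} → x ∈ ys →
          ∑ (λ y → 𝟙 (x ≟ y)) ys ≡ 1ℤ
∑-point _≟_ {y ∷ ys} (y∉ys ∷ _) {x} (here refl) = cong₂ ℤ._+_ (𝟙-yes (x ≟ x) refl)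
  (≡.trans (∑-cong-∈ ys (λ {z} z∈ys → 𝟙-no (x ≟ z) (All.lookup y∉ys z∈ys))) (∑-zero ys))
∑-point _≟_ {y ∷ ys} (y∉ys ∷ uys) {x} (there x∈ys) = cong₂ ℤ._+_
  (𝟙-no (x ≟ y) (λ x≡y → All.lookup y∉ys x∈ys (sym x≡y))) (∑-point _≟_ uys x∈ys)

-- Double counting: each x in `xs` contributes exactly once, at y = `c x`. Values y that are not
-- attained are allowed and contribute 0.
∑-fibres : (_≟_ : DecidableEquality B) (c : A → B) (xs : List A) {ys : List B} → Unique ys →
           (∀ {x} → x ∈ xs → c x ∈ ys) →
           ∑ (λ y → + length (filter (λ x → c x ≟ y) xs)) ys ≡ + length xs
∑-fibres _≟_ c xs {ys} uys c∈ys = begin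
  ∑ (λ y → + length (filter (λ x → c x ≟ y) xs)) ys
    ≡⟨ ∑-cong (λ y → length-filter≡∑𝟙 (λ x → c x ≟ y) xs) ys ⟩
  ∑ (λ y → ∑ (λ x → 𝟙 (c x ≟ y)) xs) ys
    ≡⟨ ∑-swap _ ys xs ⟩
  ∑ (λ x → ∑ (λ y → 𝟙 (c x ≟ y)) ys) xs
    ≡⟨ ∑-cong-∈ xs (λ x∈xs → ∑-point _≟_ uys (c∈ys x∈xs)) ⟩
  ∑ (λ _ → 1ℤ) xs
    ≡⟨ ∑-one xs ⟩
  + length xs ∎
  where open ≡-Reasoning

-- Deduplicating the image leaves each attained value once, so `∑-fibres` becomes a sum of equal
-- terms `n`. With `c` = `class r k` and `n` = k this counts equivalence classes.
length-constantFibres : (_≟_ : DecidableEquality B) (c : A → B) (xs : List A) (n : ℕ) →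
  (∀ {x} → x ∈ xs → length (filter (λ y → c y ≟ c x) xs) ≡ n) →
  + n ℤ.* + length (deduplicate _≟_ (map c xs)) ≡ + length xs
length-constantFibres _≟_ c xs n fibre = begin
  + n ℤ.* + length cs        ≡⟨ cong (+ n ℤ.*_) (∑-one cs) ⟨
  + n ℤ.* ∑ (λ _ → 1ℤ) cs    ≡⟨ ∑-*ˡ (+ n) _ cs ⟨
  ∑ (λ _ → + n ℤ.* 1ℤ) cs    ≡⟨ ∑-cong-∈ cs fibre-size ⟩
  ∑ (λ y → + length (filter (λ x → c x ≟ y) xs)) cs
    ≡⟨ ∑-fibres _≟_ c xs (deduplicate-! _≟_ (map c xs)) (∈-deduplicate⁺ _≟_ ∘ ∈-map⁺ c) ⟩
  + length xs                ∎
  where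
  open ≡-Reasoning
  cs = deduplicate _≟_ (map c xs)
  fibre-size : ∀ {y} → y ∈ cs → + n ℤ.* 1ℤ ≡ + length (filter (λ x → c x ≟ y) xs)
  fibre-size y∈cs with x , x∈xs , refl ← ∈-map⁻ c (∈-deduplicate⁻ _≟_ (map c xs) y∈cs) =
    ≡.trans (ℤP.*-identityʳ (+ n)) (cong +_ (sym (fibre x∈xs)))

length-filter-comm : ∀ {a p q} {A : Set a} {P : Pred A p} {Q : Pred A q}
                     (P? : Decidable P) (Q? : Decidable Q) (xs : List A) →
                     + length (filter P? (filter Q? xs)) ≡ + length (filter Q? (filter P? xs))
length-filter-comm P? Q? xs = begin
  + length (filter P? (filter Q? xs))    ≡⟨ count P? Q? ⟩
  ∑ (λ x → 𝟙 (Q? x) ℤ.* 𝟙 (P? x)) xs     ≡⟨ ∑-cong (λ x → ℤP.*-comm (𝟙 (Q? x)) (𝟙 (P? x))) xs ⟩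
  ∑ (λ x → 𝟙 (P? x) ℤ.* 𝟙 (Q? x)) xs     ≡⟨ count Q? P? ⟨
  + length (filter Q? (filter P? xs))    ∎
  where
  open ≡-Reasoning
  count : ∀ {p q} {P : Pred _ p} {Q : Pred _ q} (P? : Decidable P) (Q? : Decidable Q) →
          + length (filter P? (filter Q? xs)) ≡ ∑ (λ x → 𝟙 (Q? x) ℤ.* 𝟙 (P? x)) xs
  count P? Q? = ≡.trans (length-filter≡∑𝟙 P? (filter Q? xs)) (∑-filter Q? (𝟙 ∘ P?) xs)

-- Divisor sums of the Möbius function

divisors : ℕ → List ℕ
divisors n = map suc (filter (λ d → suc d ∣? n) (upTo n))

∈-divisors⁺ : ∀ {n s} .{{_ : NonZero n}} → s ∣ n → s ∈ divisors n
∈-divisors⁺ {n} {zero}  0∣n = contradiction (0∣⇒≡0 0∣n) (ℕ.≢-nonZero⁻¹ n)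
∈-divisors⁺ {n} {suc d} s∣n = ∈-map⁺ suc (∈-filter⁺ (λ d → suc d ∣? n) (∈-upTo⁺ (∣⇒≤ s∣n)) s∣n)

∈-divisors⁻ : ∀ {n s} → s ∈ divisors n → s ∣ n
∈-divisors⁻ {n} s∈ with d , d∈ , refl ← ∈-map⁻ suc s∈ =
  proj₂ (∈-filter⁻ (λ d → suc d ∣? n) {xs = upTo n} d∈)

divisors-unique : ∀ n → Unique (divisors n)
divisors-unique n = Unique.map⁺ ℕP.suc-injective (Unique.filter⁺ (λ d → suc d ∣? n) (Unique.upTo⁺ n))

-- Trades a summand that demands a `NonZero` instance for a total function on ℕ, to which the rules
-- for `∑` apply. The two have to agree only at actual divisors.
sumOverDivisors≡∑ : ∀ n (g : (s : ℕ) .{{_ : NonZero s}} → ℤ) (h : ℕ → ℤ) →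
                    (∀ {d} → suc d ∣ n → g (suc d) ≡ h (suc d)) →
                    sumOverDivisors n g ≡ ∑ h (divisors n)
sumOverDivisors≡∑ n g h eq = ≡.trans
  (∑-cong-∈ ds (λ d∈ → eq (proj₂ (∈-filter⁻ (λ d → suc d ∣? n) {xs = upTo n} d∈))))
  (sym (∑-map h suc ds))
  where ds = filter (λ d → suc d ∣? n) (upTo n)

-- The formula inside `μ`, freed from the particular list that `factorise` returns.
möbiusOfFactors : List ℕ → ℤ
möbiusOfFactors ps = if does (unique? _≟_ ps) then -[1+ 0 ] ℤ.^ length ps else + 0

Unique-resp-↭ : ∀ {ps qs : List ℕ} → ps ↭ qs → Unique ps → Unique qs
Unique-resp-↭ ps↭qs = PermutationS.Unique-resp-↭ (≡.setoid ℕ) (↭⇒↭ₛ ps↭qs)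

möbiusOfFactors-↭ : ∀ {ps qs} → ps ↭ qs → möbiusOfFactors ps ≡ möbiusOfFactors qs
möbiusOfFactors-↭ {ps} {qs} ps↭qs = cong₂ (if_then_else + 0)
  (does-⇔ (mk⇔ (Unique-resp-↭ ps↭qs) (Unique-resp-↭ (↭-sym ps↭qs))) (unique? _≟_ ps) (unique? _≟_ qs))
  (cong (-[1+ 0 ] ℤ.^_) (↭-length ps↭qs))

-- Extended by μ 0 = 0.
möbius : ℕ → ℤ
möbius zero    = 0ℤ
möbius (suc n) = μ (suc n)

-- Unique factorisation makes any two factor lists permutations of each other, and neither
-- distinctness nor length notices the order. So μ may be computed from whichever list is
-- convenient.
möbius≡ : ∀ {n} .{{_ : NonZero n}} (F : PrimeFactorisation n) → möbius n ≡ möbiusOfFactors (factors F)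
möbius≡ {suc n} F = möbiusOfFactors-↭ (factorisationUnique (factorise (suc n)) F)

open PrimeFactorisation using (isFactorisation; factorsPrime)

prime-*-factorisation : ∀ {p n} → Prime p → PrimeFactorisation n → PrimeFactorisation (p * n)
prime-*-factorisation {p} pp F = record
  { factors         = p ∷ factors F
  ; isFactorisation = cong (p *_) (isFactorisation F)
  ; factorsPrime    = pp ∷ factorsPrime F
  }

∣⇒∈factors : ∀ {p n} → Prime p → (F : PrimeFactorisation n) → p ∣ n → p ∈ factors F
∣⇒∈factors {p} pp F p∣n =
  factorisationHasAllPrimeFactors pp (subst (p ∣_) (isFactorisation F) p∣n) (factorsPrime F)

∈factors⇒∣ : ∀ {p n} (F : PrimeFactorisation n) → p ∈ factors F → p ∣ n
∈factors⇒∣ {p} F p∈ = subst (p ∣_) (sym (isFactorisation F)) (∈⇒∣product p∈)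

möbiusOfFactors-∷-∈ : ∀ {p ps} → p ∈ ps → möbiusOfFactors (p ∷ ps) ≡ 0ℤ
möbiusOfFactors-∷-∈ {p} {ps} p∈ps =
  cong (if_then -[1+ 0 ] ℤ.^ length (p ∷ ps) else + 0)
       (dec-false (unique? _≟_ (p ∷ ps)) λ { (p∉ps ∷ _) → All.lookup p∉ps p∈ps refl })

möbiusOfFactors-∷-∉ : ∀ {p ps} → p ∉ ps → möbiusOfFactors (p ∷ ps) ≡ ℤ.- möbiusOfFactors ps
möbiusOfFactors-∷-∉ {p} {ps} p∉ps = ≡.trans
  (cong (if_then -[1+ 0 ] ℤ.^ length (p ∷ ps) else + 0)
        (does-⇔ (mk⇔ (λ { (_ ∷ ups) → ups }) (p≢ps ∷_)) (unique? _≟_ (p ∷ ps)) (unique? _≟_ ps)))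
  (negate (does (unique? _≟_ ps)))
  where
  p≢ps = All.tabulate (λ {x} x∈ps p≡x → p∉ps (subst (_∈ ps) (sym p≡x) x∈ps))
  negate : ∀ b → (if b then -[1+ 0 ] ℤ.^ length (p ∷ ps) else + 0)
               ≡ ℤ.- (if b then -[1+ 0 ] ℤ.^ length ps else + 0)
  negate true  = ℤP.-1*i≡-i (-[1+ 0 ] ℤ.^ length ps)
  negate false = refl

-- Putting p in front of a factor list of n creates a repetition exactly when p ∣ n; otherwise the
-- list grows by one prime and the sign flips.
möbius-prime-* : ∀ {p n} .{{_ : NonZero n}} → Prime p →
                 möbius (p * n) ≡ ℤ.- (𝟙 (¬? (p ∣? n)) ℤ.* möbius n)
möbius-prime-* {p} {n} pp = ≡.trans (möbius≡ {{p*n≢0}} (prime-*-factorisation pp F)) (by-cases (p ∣? n))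
  where
  F = factorise n
  p*n≢0 = ℕP.m*n≢0 p n {{prime⇒nonZero pp}}
  by-cases : (p∣n? : Dec (p ∣ n)) →
             möbiusOfFactors (p ∷ factors F) ≡ ℤ.- (𝟙 (¬? p∣n?) ℤ.* möbius n)
  by-cases (yes p∣n) = möbiusOfFactors-∷-∈ (∣⇒∈factors pp F p∣n)
  by-cases (no ¬p∣n) = ≡.trans (möbiusOfFactors-∷-∉ (¬p∣n ∘ ∈factors⇒∣ F))
    (cong ℤ.-_ (sym (≡.trans (ℤP.*-identityˡ _) (möbius≡ F))))

∃-primeDivisor : ∀ n .{{_ : NonZero n}} → n ≢ 1 → ∃ λ p → Prime p × p ∣ n
∃-primeDivisor n n≢1 with factorise n
... | record { factors = []     ; isFactorisation = n≡1 } = contradiction n≡1 n≢1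
... | record { factors = p ∷ ps ; isFactorisation = refl ; factorsPrime = pp ∷ _ } = p , pp , m∣m*n (product ps)

-- In p m = q s, Euclid's lemma forces p into the cofactor q; cancelling p then exhibits s as a
-- divisor of m.
∣-coprime-prime : ∀ {p m s} → Prime p → p ∤ s → s ∣ p * m → s ∣ m
∣-coprime-prime {p} {m} {s} pp p∤s (divides q pm≡qs)
  with euclidsLemma q s pp (subst (p ∣_) pm≡qs (m∣m*n m))
... | inj₂ p∣s = contradiction p∣s p∤s
... | inj₁ (divides r refl) = divides r (ℕP.*-cancelˡ-≡ m (r * s) p {{prime⇒nonZero pp}} (begin
  p * m       ≡⟨ pm≡qs ⟩
  r * p * s   ≡⟨ cong (_* s) (ℕP.*-comm r p) ⟩
  p * r * s   ≡⟨ ℕP.*-assoc p r s ⟩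
  p * (r * s) ∎))
  where open ≡-Reasoning

-- The divisors of p m that p divides are the p t with t ∣ m, those that p does
-- not divide are divisors of m; since μ (p t) is − μ t or 0, the two sums cancel.
∑möbius-prime-* : ∀ p m .{{_ : NonZero m}} → Prime p → ∑ möbius (divisors (p * m)) ≡ 0ℤ
∑möbius-prime-* p m pp = begin
  ∑ möbius D
    ≡⟨ ∑-cong split D ⟩
  ∑ (λ s → 𝟙 (p ∣? s) ℤ.* möbius s ℤ.+ 𝟙 (¬? (p ∣? s)) ℤ.* möbius s) D
    ≡⟨ ∑-+ _ _ D ⟩
  ∑ (λ s → 𝟙 (p ∣? s) ℤ.* möbius s) D ℤ.+ ∑ (λ s → 𝟙 (¬? (p ∣? s)) ℤ.* möbius s) D
    ≡⟨ cong₂ ℤ._+_ (sym (∑-filter (p ∣?_) möbius D)) (sym (∑-filter (¬? ∘ (p ∣?_)) möbius D)) ⟩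
  ∑ möbius (filter (p ∣?_) D) ℤ.+ ∑ möbius (filter (¬? ∘ (p ∣?_)) D)
    ≡⟨ cong₂ ℤ._+_ multiples (∑-↭ möbius nonMultiples) ⟩
  ℤ.- E ℤ.+ ∑ möbius (filter (¬? ∘ (p ∣?_)) (divisors m))
    ≡⟨ cong (λ z → ℤ.- E ℤ.+ z) (∑-filter (¬? ∘ (p ∣?_)) möbius (divisors m)) ⟩
  ℤ.- E ℤ.+ E
    ≡⟨ ℤP.+-inverseˡ E ⟩
  0ℤ ∎
  where
  open ≡-Reasoning
  instance
    p≢0 = prime⇒nonZero pp
    pm≢0 = ℕP.m*n≢0 p m
  D = divisors (p * m)
  E = ∑ (λ t → 𝟙 (¬? (p ∣? t)) ℤ.* möbius t) (divisors m)

  split : ∀ s → möbius s ≡ 𝟙 (p ∣? s) ℤ.* möbius s ℤ.+ 𝟙 (¬? (p ∣? s)) ℤ.* möbius s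
  split s with does (p ∣? s)
  ... | true  = sym (≡.trans (ℤP.+-identityʳ _) (ℤP.*-identityˡ _))
  ... | false = sym (≡.trans (ℤP.+-identityˡ _) (ℤP.*-identityˡ _))

  nonMultiples : filter (¬? ∘ (p ∣?_)) D ↭ filter (¬? ∘ (p ∣?_)) (divisors m)
  nonMultiples = unique∧⇔⇒↭
    (Unique.filter⁺ (¬? ∘ (p ∣?_)) (divisors-unique (p * m)))
    (Unique.filter⁺ (¬? ∘ (p ∣?_)) (divisors-unique m))
    (λ s∈ → let s∈D , p∤s = ∈-filter⁻ (¬? ∘ (p ∣?_)) {xs = D} s∈ in
            ∈-filter⁺ (¬? ∘ (p ∣?_)) (∈-divisors⁺ (∣-coprime-prime pp p∤s (∈-divisors⁻ s∈D))) p∤s)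
    (λ s∈ → let s∈D , p∤s = ∈-filter⁻ (¬? ∘ (p ∣?_)) {xs = divisors m} s∈ in
            ∈-filter⁺ (¬? ∘ (p ∣?_)) (∈-divisors⁺ (∣n⇒∣m*n p (∈-divisors⁻ s∈D))) p∤s)

  multiples↭ : filter (p ∣?_) D ↭ map (p *_) (divisors m)
  multiples↭ = unique∧⇔⇒↭
    (Unique.filter⁺ (p ∣?_) (divisors-unique (p * m)))
    (Unique.map⁺ (ℕP.*-cancelˡ-≡ _ _ p) (divisors-unique m))
    to from
    where
    to : ∀ {s} → s ∈ filter (p ∣?_) D → s ∈ map (p *_) (divisors m)
    to s∈ with ∈-filter⁻ (p ∣?_) {xs = D} s∈
    ... | s∈D , divides t refl rewrite ℕP.*-comm t p =
      ∈-map⁺ (p *_) (∈-divisors⁺ (*-cancelˡ-∣ p (∈-divisors⁻ s∈D)))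
    from : ∀ {s} → s ∈ map (p *_) (divisors m) → s ∈ filter (p ∣?_) D
    from s∈ with t , t∈ , refl ← ∈-map⁻ (p *_) s∈ =
      ∈-filter⁺ (p ∣?_) (∈-divisors⁺ (*-monoʳ-∣ p (∈-divisors⁻ t∈))) (m∣m*n t)

  multiples : ∑ möbius (filter (p ∣?_) D) ≡ ℤ.- E
  multiples = begin
    ∑ möbius (filter (p ∣?_) D)       ≡⟨ ∑-↭ möbius multiples↭ ⟩
    ∑ möbius (map (p *_) (divisors m)) ≡⟨ ∑-map möbius (p *_) (divisors m) ⟩
    ∑ (λ t → möbius (p * t)) (divisors m)
      ≡⟨ ∑-cong-∈ (divisors m) (λ {t} t∈ → ≡.trans (möbius-prime-* {{∣m⇒≢0 (∈-divisors⁻ t∈)}} pp) (sym (ℤP.-1*i≡-i _))) ⟩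
    ∑ (λ t → -1ℤ ℤ.* (𝟙 (¬? (p ∣? t)) ℤ.* möbius t)) (divisors m)
      ≡⟨ ∑-*ˡ -1ℤ _ (divisors m) ⟩
    -1ℤ ℤ.* E ≡⟨ ℤP.-1*i≡-i E ⟩
    ℤ.- E ∎
    where
    ∣m⇒≢0 : ∀ {t} → t ∣ m → NonZero t
    ∣m⇒≢0 t∣m = ℕ.≢-nonZero λ { refl → ℕ.≢-nonZero⁻¹ m (0∣⇒≡0 t∣m) }

∑möbius : ∀ n .{{_ : NonZero n}} → ∑ möbius (divisors n) ≡ 𝟙 (n ≟ 1)
∑möbius n with n ≟ 1
-- Both sides evaluate: the only divisor is 1, and its factor list is empty.
... | yes refl = refl
... | no n≢1 with p , pp , divides m refl ← ∃-primeDivisor n n≢1 =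
  ≡.trans (subst (λ z → ∑ möbius (divisors z) ≡ 0ℤ) (ℕP.*-comm p m)
            (∑möbius-prime-* p m {{ℕP.m*n≢0⇒m≢0 m}} pp))
          (sym (𝟙-no (m * p ≟ 1) n≢1))

-- Rotations and periods

∈-subsets : ∀ {k} (A : Subset k) → A ∈ subsets k
∈-subsets []              = here refl
∈-subsets (outside ∷ A)   = ∈-++⁺ˡ (∈-map⁺ (outside ∷_) (∈-subsets A))
∈-subsets {suc k} (inside ∷ A) = ∈-++⁺ʳ (map (outside ∷_) (subsets k)) (∈-map⁺ (inside ∷_) (∈-subsets A))

subsets-unique : ∀ k → Unique (subsets k)
subsets-unique zero    = [] ∷ []
subsets-unique (suc k) = Unique.++⁺
  (Unique.map⁺ ∷-injectiveʳ (subsets-unique k))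
  (Unique.map⁺ ∷-injectiveʳ (subsets-unique k))
  disjoint
  where
  disjoint : ∀ {A} → ¬ (A ∈ map (outside ∷_) (subsets k) × A ∈ map (inside ∷_) (subsets k))
  disjoint (∈out , ∈in) with _ , _ , refl ← ∈-map⁻ (outside ∷_) ∈out with () ← proj₂ (proj₂ (∈-map⁻ (inside ∷_) ∈in))

length-subsets : ∀ k → length (subsets k) ≡ 2 ^ k
length-subsets zero    = refl
length-subsets (suc k) = begin
  length (map (outside ∷_) (subsets k) ++ map (inside ∷_) (subsets k))
    ≡⟨ length-++ (map (outside ∷_) (subsets k)) ⟩
  length (map (outside ∷_) (subsets k)) + length (map (inside ∷_) (subsets k))
    ≡⟨ cong₂ _+_ (≡.trans (length-map _ (subsets k)) (length-subsets k))
                 (≡.trans (length-map _ (subsets k)) (length-subsets k)) ⟩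
  2 ^ k + 2 ^ k
    ≡⟨ cong (λ z → 2 ^ k + z) (ℕP.+-identityʳ (2 ^ k)) ⟨
  2 ^ suc k ∎
  where open ≡-Reasoning

members : ∀ {k} → Subset k → List (Fin k)
members {k} A = filter (_∈? A) (allFin k)

-- Turns the size of a bit vector into the length of a list, so that invariance of size under
-- rotation can be proved by a permutation of lists.
∣∣≡length-members : ∀ {k} (A : Subset k) → + ∣ A ∣ ≡ + length (members A)
∣∣≡length-members {k} A = ≡.trans (count A) (sym (length-filter≡∑𝟙 (_∈? A) (allFin k)))
  where
  -- `allFin (suc k)` unfolds to `zero` followed by `tabulate suc`, not by `map suc (allFin k)`;
  -- this bridges the two for the induction.
  tail : ∀ {k} b (A : Subset k) → ∑ (λ x → 𝟙 (x ∈? A)) (allFin k) ≡ ∑ (λ x → 𝟙 (x ∈? (b ∷ A))) (List.tabulate Fin.suc)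
  tail {k} b A = begin
    ∑ (λ x → 𝟙 (x ∈? A)) (allFin k)
      ≡⟨ ∑-cong (λ x → 𝟙-⇔ Vec.there (λ { (Vec.there x∈A) → x∈A }) (x ∈? A) (Fin.suc x ∈? (b ∷ A))) (allFin k) ⟩
    ∑ (λ x → 𝟙 (Fin.suc x ∈? (b ∷ A))) (allFin k)
      ≡⟨ ∑-map (λ x → 𝟙 (x ∈? (b ∷ A))) Fin.suc (allFin k) ⟨
    ∑ (λ x → 𝟙 (x ∈? (b ∷ A))) (map Fin.suc (allFin k))
      ≡⟨ cong (∑ (λ x → 𝟙 (x ∈? (b ∷ A)))) (map-tabulate id Fin.suc) ⟩
    ∑ (λ x → 𝟙 (x ∈? (b ∷ A))) (List.tabulate Fin.suc) ∎
    where open ≡-Reasoning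
  count : ∀ {k} (A : Subset k) → + ∣ A ∣ ≡ ∑ (λ x → 𝟙 (x ∈? A)) (allFin k)
  count []            = refl
  count (outside ∷ A) = ≡.trans (count A) (≡.trans (tail outside A) (sym (ℤP.+-identityˡ _)))
  count (inside ∷ A)  = cong (λ z → 1ℤ ℤ.+ z) (≡.trans (count A) (tail inside A))

Bool-ext : ∀ {b c} → (b ≡ true → c ≡ true) → (c ≡ true → b ≡ true) → b ≡ c
Bool-ext {true}          to from = sym (to refl)
Bool-ext {false} {true}  to from = from refl
Bool-ext {false} {false} to from = refl

module _ {k : ℕ} .{{_ : NonZero k}} where

  mod-cong : ∀ {m n} → m % k ≡ n % k → m mod k ≡ n mod k
  mod-cong {m} {n} eq = FinP.fromℕ<-cong _ _ eq (m%n<n m k) (m%n<n n k)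

  toℕ-mod : ∀ n → toℕ (n mod k) ≡ n % k
  toℕ-mod n = FinP.toℕ-fromℕ< (m%n<n n k)

  mod-injective : ∀ {m n} → m mod k ≡ n mod k → m % k ≡ n % k
  mod-injective {m} {n} eq = ≡.trans (sym (toℕ-mod m)) (≡.trans (cong toℕ eq) (toℕ-mod n))

  toℕ-mod-id : ∀ (x : Fin k) → toℕ x mod k ≡ x
  toℕ-mod-id x = FinP.toℕ-injective (≡.trans (toℕ-mod (toℕ x)) (m<n⇒m%n≡m (FinP.toℕ<n x)))

  %-+-congˡ : ∀ {m n} j → m % k ≡ n % k → (m + j) % k ≡ (n + j) % k
  %-+-congˡ {m} {n} j eq = begin
    (m + j) % k             ≡⟨ %-distribˡ-+ m j k ⟩
    (m % k + j % k) % k     ≡⟨ cong (λ z → (z + j % k) % k) eq ⟩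
    (n % k + j % k) % k     ≡⟨ %-distribˡ-+ n j k ⟨
    (n + j) % k             ∎
    where open ≡-Reasoning

  -- Congruent to − j modulo k; the subtraction does not truncate, as k ≥ 1.
  neg : ℕ → ℕ
  neg j = j * k ∸ j

  +-neg : ∀ n j → n + neg j + j ≡ n + j * k
  +-neg n j = ≡.trans (ℕP.+-assoc n (neg j) j) (cong (λ z → n + z) (ℕP.m∸n+n≡m (ℕP.m≤m*n j k)))

  +-cancelʳ-% : ∀ {m n} j → (m + j) % k ≡ (n + j) % k → m % k ≡ n % k
  +-cancelʳ-% {m} {n} j eq = ≡.trans (sym (drop m)) (≡.trans (%-+-congˡ (neg j) eq) (drop n))
    where
    drop : ∀ m → (m + j + neg j) % k ≡ m % k
    drop m = ≡.trans
      (cong (_% k) (≡.trans (ℕP.+-assoc m j _) (≡.trans (cong (λ z → m + z) (ℕP.+-comm j _))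
        (≡.trans (sym (ℕP.+-assoc m _ j)) (+-neg m j)))))
      ([m+kn]%n≡m%n m j k)

  -- The indicator sequence of A, extended k-periodically to all of ℕ.
  at : Subset k → ℕ → Bool
  at A n = lookup A (n mod k)

  at-cong : ∀ A {m n} → m % k ≡ n % k → at A m ≡ at A n
  at-cong A eq = cong (lookup A) (mod-cong eq)

  at-toℕ : ∀ A x → at A (toℕ x) ≡ lookup A x
  at-toℕ A x = cong (lookup A) (toℕ-mod-id x)

  at-ext : ∀ {A B} → at A ≗ at B → A ≡ B
  at-ext {A} {B} eq = begin
    A                   ≡⟨ tabulate∘lookup A ⟨
    tabulate (lookup A) ≡⟨ tabulate-cong (λ x → ≡.trans (sym (at-toℕ A x)) (≡.trans (eq (toℕ x)) (at-toℕ B x))) ⟩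
    tabulate (lookup B) ≡⟨ tabulate∘lookup B ⟩
    B                   ∎
    where open ≡-Reasoning

  -- `at-rotate` gives values only at indices of the form n + j. That is enough, since modulo k
  -- every index has this form: add `neg j` first.
  at-ext-+ : ∀ {A B} j → (∀ n → at A (n + j) ≡ at B (n + j)) → A ≡ B
  at-ext-+ {A} {B} j eq = at-ext λ n →
    ≡.trans (sym (unshift A n)) (≡.trans (eq (n + neg j)) (unshift B n))
    where
    unshift : ∀ A n → at A (n + neg j + j) ≡ at A n
    unshift A n = at-cong A (≡.trans (cong (_% k) (+-neg n j)) ([m+kn]%n≡m%n n j k))

  -- Rotation of a subset and its group laws

  ∈-residues⁺ : ∀ {L a} → a ∈ L → a mod k Subset.∈ residues k L
  ∈-residues⁺ (here refl) = x∈p∪q⁺ (inj₁ (x∈⁅x⁆ _))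
  ∈-residues⁺ (there a∈L) = x∈p∪q⁺ (inj₂ (∈-residues⁺ a∈L))

  ∈-residues⁻ : ∀ L {x} → x Subset.∈ residues k L → ∃ λ a → a ∈ L × x ≡ a mod k
  ∈-residues⁻ []      x∈ = contradiction x∈ ∉⊥
  ∈-residues⁻ (a ∷ L) x∈ with x∈p∪q⁻ ⁅ a mod k ⁆ (residues k L) x∈
  ... | inj₁ x∈a = a , here refl , x∈⁅y⁆⇒x≡y _ x∈a
  ... | inj₂ x∈L with b , b∈L , eq ← ∈-residues⁻ L x∈L = b , there b∈L , eq

  -- Literally the set of residues that `PositivePeriod` and `Equivalent` compare, so both notions
  -- become equations between rotations once `residues-elements` is applied.
  rotate : ℕ → Subset k → Subset k
  rotate j A = residues k (elements A ⊕ j)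

  ∈-rotate⁺ : ∀ j {A x} → x Subset.∈ A → (toℕ x + j) mod k Subset.∈ rotate j A
  ∈-rotate⁺ j {A} {x} x∈A =
    ∈-residues⁺ (∈-map⁺ (_+ j) (∈-map⁺ toℕ (∈-filter⁺ (_∈? A) (∈-allFin x) x∈A)))

  ∈-rotate⁻ : ∀ j {A y} → y Subset.∈ rotate j A → ∃ λ x → x Subset.∈ A × y ≡ (toℕ x + j) mod k
  ∈-rotate⁻ j {A} y∈ with _ , a∈ , refl ← ∈-residues⁻ (elements A ⊕ j) y∈
    with _ , b∈ , refl ← ∈-map⁻ (_+ j) a∈
    with x , x∈ , refl ← ∈-map⁻ toℕ b∈ = x , proj₂ (∈-filter⁻ (_∈? A) {xs = allFin k} x∈) , refl

  -- The link between residue sets and periodic sequences; the composition law, injectivity and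
  -- k-periodicity of rotation all follow from it. Evaluating at n + j avoids subtracting j from an
  -- index.
  at-rotate : ∀ j A n → at (rotate j A) (n + j) ≡ at A n
  at-rotate j A n = Bool-ext to from
    where
    to : at (rotate j A) (n + j) ≡ true → at A n ≡ true
    to eq with x , x∈A , eq′ ← ∈-rotate⁻ j (lookup⇒[]= _ (rotate j A) eq) = begin
      at A n       ≡⟨ at-cong A (+-cancelʳ-% j (mod-injective eq′)) ⟩
      at A (toℕ x) ≡⟨ at-toℕ A x ⟩
      lookup A x   ≡⟨ []=⇒lookup x∈A ⟩
      true         ∎
      where open ≡-Reasoning
    from : at A n ≡ true → at (rotate j A) (n + j) ≡ true
    from eq = begin
      at (rotate j A) (n + j)
        ≡⟨ at-cong (rotate j A) (%-+-congˡ j (≡.trans (sym (m%n%n≡m%n n k)) (cong (_% k) (sym (toℕ-mod n))))) ⟩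
      at (rotate j A) (toℕ (n mod k) + j)
        ≡⟨ []=⇒lookup (∈-rotate⁺ j (lookup⇒[]= (n mod k) A eq)) ⟩
      true ∎
      where open ≡-Reasoning

  rotate-rotate : ∀ i j A → rotate j (rotate i A) ≡ rotate (i + j) A
  rotate-rotate i j A = at-ext-+ (i + j) λ n → begin
    at (rotate j (rotate i A)) (n + (i + j)) ≡⟨ cong (at (rotate j (rotate i A))) (ℕP.+-assoc n i j) ⟨
    at (rotate j (rotate i A)) (n + i + j)   ≡⟨ at-rotate j (rotate i A) (n + i) ⟩
    at (rotate i A) (n + i)                  ≡⟨ at-rotate i A n ⟩
    at A n                                   ≡⟨ at-rotate (i + j) A n ⟨
    at (rotate (i + j) A) (n + (i + j))      ∎
    where open ≡-Reasoning

  rotate-comm : ∀ i j A → rotate j (rotate i A) ≡ rotate i (rotate j A)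
  rotate-comm i j A = ≡.trans (rotate-rotate i j A)
    (≡.trans (cong (λ l → rotate l A) (ℕP.+-comm i j)) (sym (rotate-rotate j i A)))

  rotate-injective : ∀ j {A B} → rotate j A ≡ rotate j B → A ≡ B
  rotate-injective j {A} {B} eq = at-ext λ n → begin
    at A n                  ≡⟨ at-rotate j A n ⟨
    at (rotate j A) (n + j) ≡⟨ cong (λ C → at C (n + j)) eq ⟩
    at (rotate j B) (n + j) ≡⟨ at-rotate j B n ⟩
    at B n                  ∎
    where open ≡-Reasoning

  rotate-∣ : ∀ {j} → k ∣ j → ∀ A → rotate j A ≡ A
  rotate-∣ {j} k∣j A = at-ext λ n → begin
    at (rotate j A) n       ≡⟨ at-cong (rotate j A) (%-remove-+ʳ n k∣j) ⟨
    at (rotate j A) (n + j) ≡⟨ at-rotate j A n ⟩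
    at A n                  ∎
    where open ≡-Reasoning

  rotate-% : ∀ j A → rotate (j % k) A ≡ rotate j A
  rotate-% j A = begin
    rotate (j % k) A                        ≡⟨ rotate-∣ (n∣m*n (j ℕ./ k)) _ ⟨
    rotate (j ℕ./ k * k) (rotate (j % k) A)   ≡⟨ rotate-rotate (j % k) (j ℕ./ k * k) A ⟩
    rotate (j % k + j ℕ./ k * k) A            ≡⟨ cong (λ l → rotate l A) (m≡m%n+[m/n]*n j k) ⟨
    rotate j A                              ∎
    where open ≡-Reasoning

  rotate-neg : ∀ j A → rotate (neg j) (rotate j A) ≡ A
  rotate-neg j A = ≡.trans (rotate-rotate j (neg j) A) (rotate-∣
    (divides j (≡.trans (ℕP.+-comm j (neg j)) (+-neg 0 j))) A)

  -- Adding 0 to each element changes nothing, so the left side is the rotation by 0, and k ∣ 0.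
  residues-elements : ∀ A → residues k (elements A) ≡ A
  residues-elements A = ≡.trans
    (cong (residues k) (sym (≡.trans (map-cong ℕP.+-identityʳ (elements A)) (map-id (elements A)))))
    (rotate-∣ (k ∣0) A)

  ∣rotate∣ : ∀ j A → ∣ rotate j A ∣ ≡ ∣ A ∣
  ∣rotate∣ j A = ℤP.+-injective (begin
    + ∣ rotate j A ∣                ≡⟨ ∣∣≡length-members (rotate j A) ⟩
    + length (members (rotate j A)) ≡⟨ cong +_ (↭-length rotated) ⟩
    + length (map shift (members A)) ≡⟨ cong +_ (length-map shift (members A)) ⟩
    + length (members A)            ≡⟨ ∣∣≡length-members A ⟨
    + ∣ A ∣                         ∎)
    where
    open ≡-Reasoning
    shift : Fin k → Fin k
    shift x = (toℕ x + j) mod k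
    shift-injective : ∀ {x y} → shift x ≡ shift y → x ≡ y
    shift-injective {x} {y} eq = ≡.trans (sym (toℕ-mod-id x))
      (≡.trans (mod-cong (+-cancelʳ-% j (mod-injective eq))) (toℕ-mod-id y))
    rotated : members (rotate j A) ↭ map shift (members A)
    rotated = unique∧⇔⇒↭
      (Unique.filter⁺ (_∈? rotate j A) (Unique.allFin⁺ k))
      (Unique.map⁺ shift-injective (Unique.filter⁺ (_∈? A) (Unique.allFin⁺ k)))
      to from
      where
      to : ∀ {y} → y ∈ members (rotate j A) → y ∈ map shift (members A)
      to y∈ with x , x∈A , refl ← ∈-rotate⁻ j (proj₂ (∈-filter⁻ (_∈? rotate j A) {xs = allFin k} y∈)) =
        ∈-map⁺ shift (∈-filter⁺ (_∈? A) (∈-allFin x) x∈A)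
      from : ∀ {y} → y ∈ map shift (members A) → y ∈ members (rotate j A)
      from y∈ with x , x∈ , refl ← ∈-map⁻ shift y∈ =
        ∈-filter⁺ (_∈? rotate j A) (∈-allFin _) (∈-rotate⁺ j (proj₂ (∈-filter⁻ (_∈? A) {xs = allFin k} x∈)))

  rotate-* : ∀ d q {A} → rotate d A ≡ A → rotate (q * d) A ≡ A
  rotate-* d zero    {A} eq = rotate-∣ (k ∣0) A
  rotate-* d (suc q) {A} eq = begin
    rotate (d + q * d) A         ≡⟨ rotate-rotate d (q * d) A ⟨
    rotate (q * d) (rotate d A)  ≡⟨ cong (rotate (q * d)) eq ⟩
    rotate (q * d) A             ≡⟨ rotate-* d q eq ⟩
    A                            ∎
    where open ≡-Reasoning

  -- The least period and the rotations that fix a set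

  f≥1 : ∀ A → 1 ≤ f k A
  f≥1 A = proj₁ (proj₁ (proj₂ (least (positivePeriod? k A) k (positivePeriod[i] k A))))

  rotate-f : ∀ A → rotate (f k A) A ≡ A
  rotate-f A = ≡.trans
    (sym (proj₂ (proj₁ (proj₂ (least (positivePeriod? k A) k (positivePeriod[i] k A))))))
    (residues-elements A)

  f-minimal : ∀ A {l} → 1 ≤ l → rotate l A ≡ A → f k A ≤ l
  f-minimal A 1≤l eq = proj₂ (proj₂ (least (positivePeriod? k A) k (positivePeriod[i] k A)))
    (1≤l , ≡.trans (residues-elements A) (sym eq))

  f∣⇒rotate : ∀ {A l} → f k A ∣ l → rotate l A ≡ A
  f∣⇒rotate {A} (divides q refl) = rotate-* (f k A) q (rotate-f A)

  -- Division with remainder: rotation by the multiple of f k A below l fixes A, hence so does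
  -- rotation by the remainder. The remainder is smaller than the least positive period, so it is 0.
  rotate⇒f∣ : ∀ {A l} → rotate l A ≡ A → f k A ∣ l
  rotate⇒f∣ {A} {l} eq = m%n≡0⇒n∣m l d (ℕP.n<1⇒n≡0 (ℕP.≰⇒> λ 1≤r →
    ℕP.<⇒≱ (m%n<n l d) (f-minimal A 1≤r remainder)))
    where
    open ≡-Reasoning
    d = f k A
    instance d≢0 : NonZero d
             d≢0 = ℕ.>-nonZero (f≥1 A)
    remainder : rotate (l % d) A ≡ A
    remainder = begin
      rotate (l % d) A                       ≡⟨ cong (rotate (l % d)) (rotate-* d (l ℕ./ d) (rotate-f A)) ⟨
      rotate (l % d) (rotate (l ℕ./ d * d) A)  ≡⟨ rotate-comm (l ℕ./ d * d) (l % d) A ⟩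
      rotate (l ℕ./ d * d) (rotate (l % d) A)  ≡⟨ rotate-rotate (l % d) (l ℕ./ d * d) A ⟩
      rotate (l % d + l ℕ./ d * d) A           ≡⟨ cong (λ n → rotate n A) (m≡m%n+[m/n]*n l d) ⟨
      rotate l A                             ≡⟨ eq ⟩
      A                                      ∎

  f∣k : ∀ A → f k A ∣ k
  f∣k A = rotate⇒f∣ (rotate-∣ ∣-refl A)

  -- Rotations commute and are injective, so A and its rotation are fixed by the same rotations;
  -- each period therefore divides the other.
  f-rotate : ∀ j A → f k (rotate j A) ≡ f k A
  f-rotate j A = ∣-antisym
    (rotate⇒f∣ (≡.trans (rotate-comm j (f k A) A) (cong (rotate j) (rotate-f A))))
    (rotate⇒f∣ (rotate-injective j (≡.trans (rotate-comm (f k (rotate j A)) j A) (rotate-f (rotate j A)))))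

  -- Equivalence as lying in one rotation orbit

  equivalent⇒rotate : ∀ {A B} → Equivalent k A B → ∃ λ j → rotate j A ≡ B
  equivalent⇒rotate {A} {B} (j , eq) = toℕ j , ≡.trans eq (residues-elements B)

  -- The definition asks for a shift below k; reducing modulo k lets any natural number serve, such
  -- as `neg j` for symmetry or i + j for transitivity.
  rotate⇒equivalent : ∀ j {A B} → rotate j A ≡ B → Equivalent k A B
  rotate⇒equivalent j {A} {B} eq = j mod k , (begin
    rotate (toℕ (j mod k)) A ≡⟨ cong (λ l → rotate l A) (toℕ-mod j) ⟩
    rotate (j % k) A         ≡⟨ rotate-% j A ⟩
    rotate j A               ≡⟨ eq ⟩
    B                        ≡⟨ residues-elements B ⟨
    residues k (elements B)  ∎)
    where open ≡-Reasoning

  equivalent-sym : ∀ {A B} → Equivalent k A B → Equivalent k B A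
  equivalent-sym {A} A~B with j , refl ← equivalent⇒rotate A~B = rotate⇒equivalent (neg j) (rotate-neg j A)

  equivalent-trans : ∀ {A B C} → Equivalent k A B → Equivalent k B C → Equivalent k A C
  equivalent-trans {A} A~B B~C with i , refl ← equivalent⇒rotate A~B with j , refl ← equivalent⇒rotate B~C =
    rotate⇒equivalent (i + j) (sym (rotate-rotate i j A))

  -- An invariant set is determined by its pattern on 0, ..., d-1, and every such pattern occurs:
  -- because d ∣ k, repeating it is consistent with wrapping around at k.
  length-rotate-invariant : ∀ d .{{_ : NonZero d}} → d ∣ k →
    length (filter (λ A → rotate d A ≟ˢ A) (subsets k)) ≡ 2 ^ d
  length-rotate-invariant d d∣k = begin
    length (filter invariant? (subsets k)) ≡⟨ ↭-length (unique∧⇔⇒↭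
      (Unique.filter⁺ invariant? (subsets-unique k))
      (Unique.map⁺ extend-injective (subsets-unique d)) to from) ⟩
    length (map extend (subsets d)) ≡⟨ length-map extend (subsets d) ⟩
    length (subsets d)              ≡⟨ length-subsets d ⟩
    2 ^ d                           ∎
    where
    open ≡-Reasoning
    invariant? = λ A → rotate d A ≟ˢ A
    atᵈ : Subset d → ℕ → Bool
    atᵈ B n = lookup B (n mod d)
    extend : Subset d → Subset k
    extend B = tabulate (λ x → atᵈ B (toℕ x))
    at-extend : ∀ B n → at (extend B) n ≡ atᵈ B n
    at-extend B n = ≡.trans (lookup∘tabulate _ (n mod k)) (cong (lookup B) (FinP.fromℕ<-cong _ _
      (≡.trans (cong (_% d) (toℕ-mod n)) (m∣n⇒o%n%m≡o%m d k n d∣k)) (m%n<n _ d) (m%n<n n d)))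
    extend-injective : ∀ {B C} → extend B ≡ extend C → B ≡ C
    extend-injective {B} {C} eq = begin
      B                   ≡⟨ tabulate∘lookup B ⟨
      tabulate (lookup B) ≡⟨ tabulate-cong (λ x → begin
        lookup B x              ≡⟨ atᵈ-toℕ B x ⟨
        atᵈ B (toℕ x)           ≡⟨ at-extend B (toℕ x) ⟨
        at (extend B) (toℕ x)   ≡⟨ cong (λ A → at A (toℕ x)) eq ⟩
        at (extend C) (toℕ x)   ≡⟨ at-extend C (toℕ x) ⟩
        atᵈ C (toℕ x)           ≡⟨ atᵈ-toℕ C x ⟩
        lookup C x              ∎) ⟩
      tabulate (lookup C) ≡⟨ tabulate∘lookup C ⟩
      C                   ∎
      where
      atᵈ-toℕ : ∀ B x → atᵈ B (toℕ x) ≡ lookup B x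
      atᵈ-toℕ B x = cong (lookup B) (FinP.toℕ-injective
        (≡.trans (FinP.toℕ-fromℕ< (m%n<n (toℕ x) d)) (m<n⇒m%n≡m (FinP.toℕ<n x))))
    to : ∀ {A} → A ∈ filter invariant? (subsets k) → A ∈ map extend (subsets d)
    to {A} A∈ = subst (_∈ map extend (subsets d)) (at-ext extends) (∈-map⁺ extend (∈-subsets A₀))
      where
      A₀ : Subset d
      A₀ = tabulate (λ x → at A (toℕ x))
      invariant : rotate d A ≡ A
      invariant = proj₂ (∈-filter⁻ invariant? {xs = subsets k} A∈)
      extends : ∀ n → at (extend A₀) n ≡ at A n
      extends n = begin
        at (extend A₀) n          ≡⟨ at-extend A₀ n ⟩
        atᵈ A₀ n                  ≡⟨ lookup∘tabulate _ (n mod d) ⟩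
        at A (toℕ (n mod d))     ≡⟨ cong (at A) (FinP.toℕ-fromℕ< (m%n<n n d)) ⟩
        -- n and n % d differ by a multiple of d, and rotation by any multiple of d fixes A.
        at A (n % d)             ≡⟨ at-rotate (n ℕ./ d * d) A (n % d) ⟨
        at (rotate (n ℕ./ d * d) A) (n % d + n ℕ./ d * d) ≡⟨ cong₂ at (rotate-* d (n ℕ./ d) invariant) (sym (m≡m%n+[m/n]*n n d)) ⟩
        at A n                   ∎
    from : ∀ {A} → A ∈ map extend (subsets d) → A ∈ filter invariant? (subsets k)
    from A∈ with B , _ , refl ← ∈-map⁻ extend A∈ = ∈-filter⁺ invariant? (∈-subsets (extend B))
      (at-ext-+ d λ n → begin
        at (rotate d (extend B)) (n + d) ≡⟨ at-rotate d (extend B) n ⟩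
        at (extend B) n                  ≡⟨ at-extend B n ⟩
        atᵈ B n                          ≡⟨ cong (lookup B) (FinP.fromℕ<-cong _ _ (sym ([m+n]%n≡m%n n d)) (m%n<n n d) (m%n<n (n + d) d)) ⟩
        atᵈ B (n + d)                    ≡⟨ at-extend B (n + d) ⟨
        at (extend B) (n + d)            ∎)

-- Counting subsets of full period

module _ {k : ℕ} .{{_ : NonZero k}} where

  -- A coincidence of the rotations by i < j would make j - i a positive period of A below k.
  rotate-distinct : ∀ {A : Subset k} → f k A ≡ k → ∀ {i j} → i < j → j < k → rotate i A ≢ rotate j A
  rotate-distinct {A} fA≡k {i} {j} i<j j<k eq = ℕP.<⇒≱ (ℕP.≤-<-trans (ℕP.m∸n≤m j i) j<k)
    (subst (_≤ j ∸ i) fA≡k (f-minimal A (ℕP.m<n⇒0<n∸m i<j) (rotate-injective i (begin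
      rotate i (rotate (j ∸ i) A) ≡⟨ rotate-rotate (j ∸ i) i A ⟩
      rotate (j ∸ i + i) A        ≡⟨ cong (λ l → rotate l A) (ℕP.m∸n+n≡m (ℕP.<⇒≤ i<j)) ⟩
      rotate j A                  ≡⟨ eq ⟨
      rotate i A                  ∎))))
    where open ≡-Reasoning

  fullPeriod? : (A : Subset k) → Dec (f k A ≡ k)
  fullPeriod? A = f k A ≟ k

  module _ (r : ℕ) where

    private
      size? : (A : Subset k) → Dec (∣ A ∣ ≡ r)
      size? A = ∣ A ∣ ≟ r

    ∈-𝒜ₛ⁺ : ∀ {A} → ∣ A ∣ ≡ r → f k A ≡ k → A ∈ 𝒜ₛ k r k
    ∈-𝒜ₛ⁺ {A} size full = ∈-filter⁺ fullPeriod? (∈-filter⁺ size? (∈-subsets A) size) full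

    ∈-𝒜ₛ⁻ : ∀ {A} → A ∈ 𝒜ₛ k r k → ∣ A ∣ ≡ r × f k A ≡ k
    ∈-𝒜ₛ⁻ A∈ = let A∈𝒜 , full = ∈-filter⁻ fullPeriod? {xs = 𝒜 r k} A∈ in
      proj₂ (∈-filter⁻ size? {xs = subsets k} A∈𝒜) , full

    𝒜ₛ-unique : Unique (𝒜ₛ k r k)
    𝒜ₛ-unique = Unique.filter⁺ fullPeriod? (Unique.filter⁺ size? (subsets-unique k))

    rotate-∈-𝒜ₛ : ∀ j {A} → A ∈ 𝒜ₛ k r k → rotate j A ∈ 𝒜ₛ k r k
    rotate-∈-𝒜ₛ j {A} A∈ = let size , full = ∈-𝒜ₛ⁻ A∈ in
      ∈-𝒜ₛ⁺ (≡.trans (∣rotate∣ j A) size) (≡.trans (f-rotate j A) full)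

    -- Both classes filter the same list by predicates that agree everywhere, so they are equal as
    -- lists, order included.
    equivalent⇒class≡ : ∀ {A B} → Equivalent k A B → class r k A ≡ class r k B
    equivalent⇒class≡ {A} {B} A~B = filter-≐ (equivalent? k A) (equivalent? k B)
      (equivalent-trans (equivalent-sym A~B) , equivalent-trans A~B) (𝒜ₛ k r k)

    -- B lies in its own class through rotation by 0, hence in the class of A.
    class≡⇒equivalent : ∀ {A B} → B ∈ 𝒜ₛ k r k → class r k B ≡ class r k A → Equivalent k A B
    class≡⇒equivalent {A} {B} B∈ eq = proj₂ (∈-filter⁻ (equivalent? k A) {xs = 𝒜ₛ k r k}
      (subst (B ∈_) eq (∈-filter⁺ (equivalent? k B) B∈ (rotate⇒equivalent 0 (rotate-∣ (k ∣0) B)))))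

    -- The fibre is the rotation orbit of A: size and period are invariant, so the orbit stays
    -- inside `𝒜ₛ k r k`, and full period makes the rotations by 0, ..., k-1 distinct.
    length-class-fibre : ∀ {A} → A ∈ 𝒜ₛ k r k →
      length (filter (λ B → ≡-dec _≟ˢ_ (class r k B) (class r k A)) (𝒜ₛ k r k)) ≡ k
    length-class-fibre {A} A∈ = begin
      length (filter sameClass? (𝒜ₛ k r k))       ≡⟨ ↭-length fibre↭ ⟩
      length (applyUpTo (λ j → rotate j A) k) ≡⟨ length-applyUpTo (λ j → rotate j A) k ⟩
      k                                            ∎
      where
      open ≡-Reasoning
      sameClass? = λ B → ≡-dec _≟ˢ_ (class r k B) (class r k A)
      rotated : ∀ {B} → (∃ λ j → rotate j A ≡ B) → B ∈ applyUpTo (λ j → rotate j A) k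
      rotated (j , refl) = subst (_∈ applyUpTo (λ j → rotate j A) k) (rotate-% j A)
        (∈-applyUpTo⁺ (λ j → rotate j A) (m%n<n j k))
      to : ∀ {B} → B ∈ filter sameClass? (𝒜ₛ k r k) → B ∈ applyUpTo (λ j → rotate j A) k
      to B∈ = let B∈𝒜ₛ , same = ∈-filter⁻ sameClass? {xs = 𝒜ₛ k r k} B∈ in
        rotated (equivalent⇒rotate (class≡⇒equivalent B∈𝒜ₛ same))
      sameClass : ∀ {B} → (∃ λ j → j < k × B ≡ rotate j A) → B ∈ filter sameClass? (𝒜ₛ k r k)
      sameClass (j , _ , refl) =
        ∈-filter⁺ sameClass? (rotate-∈-𝒜ₛ j A∈) (sym (equivalent⇒class≡ (rotate⇒equivalent j refl)))
      from : ∀ {B} → B ∈ applyUpTo (λ j → rotate j A) k → B ∈ filter sameClass? (𝒜ₛ k r k)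
      from = sameClass ∘ ∈-applyUpTo⁻ (λ j → rotate j A)
      fibre↭ : filter sameClass? (𝒜ₛ k r k) ↭ applyUpTo (λ j → rotate j A) k
      fibre↭ = unique∧⇔⇒↭ (Unique.filter⁺ sameClass? 𝒜ₛ-unique)
        (Unique.applyUpTo⁺₁ (λ j → rotate j A) k (rotate-distinct (proj₂ (∈-𝒜ₛ⁻ A∈)))) to from

    k*length-𝒫 : + k ℤ.* + length (𝒫 r k) ≡ + length (𝒜ₛ k r k)
    k*length-𝒫 = length-constantFibres (≡-dec _≟ˢ_) (class r k) (𝒜ₛ k r k) k length-class-fibre

  rotate-empty : ∀ j → rotate j (⊥ {k}) ≡ ⊥
  rotate-empty j = Empty-unique λ (y , y∈) → let _ , x∈⊥ , _ = ∈-rotate⁻ j y∈ in ∉⊥ x∈⊥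

  -- Here k ≥ 2 enters. For k = 1 the empty set has period 1 = k and would be counted in N, although
  -- its size 0 lies outside the sum defining `R`.
  1≤∣fullPeriod∣ : k ≥ 2 → ∀ {A : Subset k} → f k A ≡ k → 1 ≤ ∣ A ∣
  1≤∣fullPeriod∣ k≥2 {A} full with nonempty? A
  ... | yes (x , x∈A) = ℕP.≤-<-trans z≤n (x∈p⇒∣p-x∣<∣p∣ x∈A)
  ... | no empty with refl ← Empty-unique empty =
    contradiction (subst (_≤ 1) full (f-minimal ⊥ ℕP.≤-refl (rotate-empty 1))) (ℕP.<⇒≱ k≥2)

  k*R : k ≥ 2 → + k ℤ.* + R k ≡ + length (filter fullPeriod? (subsets k))
  k*R k≥2 = begin
    + k ℤ.* + R k
      ≡⟨ cong (+ k ℤ.*_) (≡.trans (+sum≡∑ (map (λ r → length (𝒫 r k)) [1⋯ k ])) (∑-map +_ (λ r → length (𝒫 r k)) [1⋯ k ])) ⟩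
    + k ℤ.* ∑ (λ r → + length (𝒫 r k)) [1⋯ k ]
      ≡⟨ ∑-*ˡ (+ k) (λ r → + length (𝒫 r k)) [1⋯ k ] ⟨
    ∑ (λ r → + k ℤ.* + length (𝒫 r k)) [1⋯ k ]
      ≡⟨ ∑-cong (λ r → ≡.trans (k*length-𝒫 r) (length-filter-comm fullPeriod? (λ A → ∣ A ∣ ≟ r) (subsets k))) [1⋯ k ] ⟩
    ∑ (λ r → + length (filter (λ A → ∣ A ∣ ≟ r) (filter fullPeriod? (subsets k)))) [1⋯ k ]
      -- The sizes 1, ..., k exhaust the full-period sets, so summing over r removes the condition
      -- on size.
      ≡⟨ ∑-fibres _≟_ ∣_∣ (filter fullPeriod? (subsets k)) (Unique.map⁺ ℕP.suc-injective (Unique.upTo⁺ k))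
           (λ {A} A∈ → ∈[1⋯] (1≤∣fullPeriod∣ k≥2 (proj₂ (∈-filter⁻ fullPeriod? {xs = subsets k} A∈))) (∣p∣≤n A)) ⟩
    + length (filter fullPeriod? (subsets k)) ∎
    where
    open ≡-Reasoning
    ∈[1⋯] : ∀ {r} → 1 ≤ r → r ≤ k → r ∈ [1⋯ k ]
    ∈[1⋯] {suc r} _ r<k = ∈-map⁺ suc (∈-upTo⁺ r<k)

  -- The value at 0 is never used.
  k/_ : ℕ → ℕ
  k/ zero  = 0
  k/ suc d = k ℕ./ suc d

  s*k/s : ∀ {s} → s ∣ k → s * (k/ s) ≡ k
  s*k/s {zero}  0∣k = contradiction (0∣⇒≡0 0∣k) (ℕ.≢-nonZero⁻¹ k)
  s*k/s {suc d} s∣k = m*[n/m]≡n s∣k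

  -- Here `e` is k / f k A. For s ∣ k the equation s (k/s) = k = e (f k A) shows that s ∣ e exactly
  -- when f k A ∣ k/s, that is, when rotation by k/s fixes A.
  𝟙-fullPeriod : ∀ (A : Subset k) e → k ≡ e * f k A →
    𝟙 (fullPeriod? A) ≡ ∑ (λ s → 𝟙 (rotate (k/ s) A ≟ˢ A) ℤ.* möbius s) (divisors k)
  𝟙-fullPeriod A e k≡e*d = begin
    𝟙 (fullPeriod? A)                        ≡⟨ 𝟙-⇔ full⇒e≡1 e≡1⇒full (fullPeriod? A) (e ≟ 1) ⟩
    𝟙 (e ≟ 1)                                ≡⟨ ∑möbius e ⟨
    ∑ möbius (divisors e)                    ≡⟨ ∑-↭ möbius divisors-e↭ ⟩
    -- Ranging over the divisors of k and moving the condition s ∣ e into an indicator makes the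
    -- range independent of A, so that the sums over A and s can later be exchanged.
    ∑ möbius (filter (_∣? e) (divisors k))   ≡⟨ ∑-filter (_∣? e) möbius (divisors k) ⟩
    ∑ (λ s → 𝟙 (s ∣? e) ℤ.* möbius s) (divisors k)
      ≡⟨ ∑-cong-∈ (divisors k) (λ {s} s∈ → cong (ℤ._* möbius s) (𝟙-⇔
           (f∣⇒rotate ∘ s∣e⇒d∣k/s (∈-divisors⁻ s∈)) (d∣k/s⇒s∣e (∈-divisors⁻ s∈) ∘ rotate⇒f∣)
           (s ∣? e) (rotate (k/ s) A ≟ˢ A))) ⟩
    ∑ (λ s → 𝟙 (rotate (k/ s) A ≟ˢ A) ℤ.* möbius s) (divisors k) ∎
    where
    open ≡-Reasoning
    d = f k A
    instance
      d≢0 : NonZero d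
      d≢0 = ℕ.>-nonZero (f≥1 A)
      e≢0 : NonZero e
      e≢0 = ℕ.≢-nonZero λ { refl → ℕ.≢-nonZero⁻¹ k k≡e*d }
    full⇒e≡1 : d ≡ k → e ≡ 1
    full⇒e≡1 d≡k = ℕP.*-cancelʳ-≡ e 1 d (≡.trans (sym k≡e*d) (≡.trans (sym d≡k) (sym (ℕP.*-identityˡ d))))
    e≡1⇒full : e ≡ 1 → d ≡ k
    e≡1⇒full refl = sym (≡.trans k≡e*d (ℕP.*-identityˡ d))
    s∣e⇒d∣k/s : ∀ {s} → s ∣ k → s ∣ e → d ∣ k/ s
    s∣e⇒d∣k/s {s} s∣k s∣e = *-cancelˡ-∣ s {{ℕ.≢-nonZero λ { refl → ℕ.≢-nonZero⁻¹ k (0∣⇒≡0 s∣k) }}}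
      (subst (s * d ∣_) (≡.trans (sym k≡e*d) (sym (s*k/s s∣k))) (*-monoˡ-∣ d s∣e))
    d∣k/s⇒s∣e : ∀ {s} → s ∣ k → d ∣ k/ s → s ∣ e
    d∣k/s⇒s∣e {s} s∣k d∣k/s = *-cancelʳ-∣ d
      (subst (s * d ∣_) (≡.trans (s*k/s s∣k) k≡e*d) (*-monoʳ-∣ s d∣k/s))
    divisors-e↭ : divisors e ↭ filter (_∣? e) (divisors k)
    divisors-e↭ = unique∧⇔⇒↭ (divisors-unique e) (Unique.filter⁺ (_∣? e) (divisors-unique k))
      (λ s∈ → ∈-filter⁺ (_∣? e) (∈-divisors⁺ (subst (_ ∣_) (sym k≡e*d) (∣m⇒∣m*n d (∈-divisors⁻ {e} s∈)))) (∈-divisors⁻ s∈))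
      (λ s∈ → ∈-divisors⁺ (proj₂ (∈-filter⁻ (_∣? e) {xs = divisors k} s∈)))

  length-fullPeriod : + length (filter fullPeriod? (subsets k)) ≡ ∑[ s ∣ k ] (μ s ℤ.* + (2 ^ (k ℕ./ s)))
  length-fullPeriod = begin
    + length (filter fullPeriod? (subsets k))
      ≡⟨ length-filter≡∑𝟙 fullPeriod? (subsets k) ⟩
    ∑ (λ A → 𝟙 (fullPeriod? A)) (subsets k)
      ≡⟨ ∑-cong (λ A → 𝟙-fullPeriod A (quotient (f∣k A)) (m∣n⇒n≡quotient*m (f∣k A))) (subsets k) ⟩
    ∑ (λ A → ∑ (λ s → 𝟙 (rotate (k/ s) A ≟ˢ A) ℤ.* möbius s) (divisors k)) (subsets k)
      ≡⟨ ∑-swap (λ A s → 𝟙 (rotate (k/ s) A ≟ˢ A) ℤ.* möbius s) (subsets k) (divisors k) ⟩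
    ∑ (λ s → ∑ (λ A → 𝟙 (rotate (k/ s) A ≟ˢ A) ℤ.* möbius s) (subsets k)) (divisors k)
      ≡⟨ ∑-cong-∈ (divisors k) (count ∘ ∈-divisors⁻) ⟩
    ∑ (λ s → möbius s ℤ.* + (2 ^ (k/ s))) (divisors k)
      -- At a successor, `möbius` and `k/_` reduce to `μ` and to division by definition.
      ≡⟨ sumOverDivisors≡∑ k (λ s → μ s ℤ.* + (2 ^ (k ℕ./ s))) _ (λ _ → refl) ⟨
    ∑[ s ∣ k ] (μ s ℤ.* + (2 ^ (k ℕ./ s))) ∎
    where
    open ≡-Reasoning
    count : ∀ {s} → s ∣ k → ∑ (λ A → 𝟙 (rotate (k/ s) A ≟ˢ A) ℤ.* möbius s) (subsets k)
                          ≡ möbius s ℤ.* + (2 ^ (k/ s))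
    count {s} s∣k = begin
      ∑ (λ A → 𝟙 (rotate (k/ s) A ≟ˢ A) ℤ.* möbius s) (subsets k)
        ≡⟨ ∑-cong (λ A → ℤP.*-comm (𝟙 (rotate (k/ s) A ≟ˢ A)) (möbius s)) (subsets k) ⟩
      ∑ (λ A → möbius s ℤ.* 𝟙 (rotate (k/ s) A ≟ˢ A)) (subsets k)
        ≡⟨ ∑-*ˡ (möbius s) (λ A → 𝟙 (rotate (k/ s) A ≟ˢ A)) (subsets k) ⟩
      möbius s ℤ.* ∑ (λ A → 𝟙 (rotate (k/ s) A ≟ˢ A)) (subsets k)
        ≡⟨ cong (möbius s ℤ.*_) (length-filter≡∑𝟙 (λ A → rotate (k/ s) A ≟ˢ A) (subsets k)) ⟨
      möbius s ℤ.* + length (filter (λ A → rotate (k/ s) A ≟ˢ A) (subsets k))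
        ≡⟨ cong (λ n → möbius s ℤ.* + n) (length-rotate-invariant (k/ s) (divides s (sym (s*k/s s∣k)))) ⟩
      möbius s ℤ.* + (2 ^ (k/ s)) ∎
      where
      instance
        k/s≢0 : NonZero (k/ s)
        k/s≢0 = ℕ.≢-nonZero λ k/s≡0 → ℕ.≢-nonZero⁻¹ k
          (≡.trans (sym (s*k/s s∣k)) (≡.trans (cong (s *_) k/s≡0) (ℕP.*-zeroʳ s)))

-- From integers to rational numbers

/1≡/ : ∀ i j n .{{_ : NonZero n}} → + n ℤ.* i ≡ j → i / 1 ≡ j / n
-- Both sides are normalised fractions; before normalisation the equation is just the cross product
-- of `i` over 1 and `j` over `suc n`.
/1≡/ i j (suc n) eq = fromℚᵘ-cong {mkℚᵘ i 0} {mkℚᵘ j n}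
  (*≡* (≡.trans (ℤP.*-comm i (+ suc n)) (≡.trans eq (sym (ℤP.*-identityʳ j)))))

theorem3 : (k : ℕ) .{{_ : NonZero k}} → k ≥ 2 →
    ((+ R k) / 1 ≡ M 2 k) ×
    (M 2 k ≡ (∑[ s ∣ k ] (+ (2 ^ (k ℕ./ s)) ℤ.* μ s)) / k)
theorem3 k k≥2 = /1≡/ (+ R k) _ k (≡.trans (k*R k≥2) length-fullPeriod) , cong (_/ k) (begin
  ∑[ s ∣ k ] (μ s ℤ.* + (2 ^ (k ℕ./ s)))
    ≡⟨ sumOverDivisors≡∑ k (λ s → μ s ℤ.* + (2 ^ (k ℕ./ s))) h (λ {d} _ → ℤP.*-comm (μ (suc d)) (+ (2 ^ (k ℕ./ suc d)))) ⟩
  ∑ h (divisors k)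
    ≡⟨ sumOverDivisors≡∑ k (λ s → + (2 ^ (k ℕ./ s)) ℤ.* μ s) h (λ _ → refl) ⟨
  ∑[ s ∣ k ] (+ (2 ^ (k ℕ./ s)) ℤ.* μ s) ∎)
  where
  open ≡-Reasoning
  h : ℕ → ℤ
  h s = + (2 ^ (k/ s)) ℤ.* möbius s
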